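{- The value $\operatorname{bdim}(G-e)-\operatorname{bdim}(G)$ can be arbitrarily larger than $d_{G-e}(u,v)$, where $e=uv$: for every $M$ there exist a connected graph $G$ and an edge $e=uv\in E(G)$ such that $G-e$ is connected and $\operatorname{bdim}(G-e)-\operatorname{bdim}(G)-d_{G-e}(u,v)\ge M$.
   Context: All graphs are finite, simple and undirected. $d_H(u,v)$ denotes the distance in graph $H$, and for a positive integer $k$, $d_k(u,v)=\min\{d(u,v),k+1\}$. A function $f:V(G)\to\mathbb{Z}_{\ge0}$ is a resolving broadcast of $G$ if for any distinct $x,y\in V(G)$ there is $z$ with $f(z)>0$ and $d_{f(z)}(x,z)\ne d_{f(z)}(y,z)$; $\operatorname{bdim}(G)$ is the minimum of $\sum_v f(v)$ over resolving broadcasts $f$ of $G$. $G-e$ denotes $G$ with the edge $e$ removed. -}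

module Defs where

open import Data.Nat using (ℕ; zero; suc; _+_; _≤_; _<_; _>_)
open import Data.Bool using (Bool; true; false; _∧_; _∨_; not; T)
open import Data.Bool.Properties using (∧-comm; ∨-comm)
open import Data.Fin using (Fin)
open import Data.Fin.Properties using () renaming (_≟_ to _≟F_)
open import Data.Nat.Properties using () renaming (_≟_ to _≟N_)
open import Data.Vec.Functional using (foldr)
open import Data.Sum using (_⊎_)
open import Data.Product using (Σ; ∃; _×_; _,_)
open import Relation.Nullary using (¬_; does)
open import Relation.Binary.PropositionalEquality using (_≡_; refl; cong₂)

record Graph (n : ℕ) : Set where
  field
    adj    : Fin n → Fin n → Bool
    sym    : ∀ x y → adj x y ≡ adj y x
    irrefl : ∀ x → adj x x ≡ false
open Graph public

_==_ : ∀ {n} → Fin n → Fin n → Bool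
x == y = does (x ≟F y)

Edge : ∀ {n} → Graph n → Fin n → Fin n → Set
Edge G u v = T (adj G u v)

removeEdge : ∀ {n} → Graph n → Fin n → Fin n → Graph n
removeEdge {n} G u v = record { adj = a ; sym = s ; irrefl = i }
  where
  hit : Fin n → Fin n → Bool
  hit x y = (x == u ∧ y == v) ∨ (x == v ∧ y == u)
  a : Fin n → Fin n → Bool
  a x y = adj G x y ∧ not (hit x y)
  s : ∀ x y → a x y ≡ a y x
  s x y rewrite ∧-comm (x == u) (y == v) | ∧-comm (x == v) (y == u)
              | ∨-comm (y == v ∧ x == u) (y == u ∧ x == v)
    = cong₂ (λ p q → p ∧ not q) (sym G x y) refl
  i : ∀ x → a x x ≡ false
  i x rewrite irrefl G x = refl

data Walk {n} (G : Graph n) : Fin n → Fin n → ℕ → Set where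
  here : ∀ {x} → Walk G x x zero
  step : ∀ {x y z k} → Edge G x y → Walk G y z k → Walk G x z (suc k)

Connected : ∀ {n} → Graph n → Set
Connected {n} G = ∀ x y → ∃ λ k → Walk G x y k

IsDist : ∀ {n} → Graph n → Fin n → Fin n → ℕ → Set
IsDist G x y d = Walk G x y d × (∀ k → Walk G x y k → d ≤ k)

-- d_k(x,y) = min{d(x,y), k+1}, as a relation (for connected graphs)
IsTruncDist : ∀ {n} → Graph n → ℕ → Fin n → Fin n → ℕ → Set
IsTruncDist G k x y t =
  ∃ λ d → IsDist G x y d × ((d ≤ k × t ≡ d) ⊎ (k < d × t ≡ suc k))

sumF : ∀ {n} → (Fin n → ℕ) → ℕ
sumF f = foldr _+_ 0 f

Resolving : ∀ {n} → Graph n → (Fin n → ℕ) → Set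
Resolving {n} G f =
  ∀ x y → ¬ x ≡ y →
    ∃ λ z → f z > 0 × ∃ λ s → ∃ λ t →
      IsTruncDist G (f z) x z s × IsTruncDist G (f z) y z t × ¬ s ≡ t

IsBdim : ∀ {n} → Graph n → ℕ → Set
IsBdim {n} G b =
  (∃ λ f → Resolving G f × sumF f ≡ b) ×
  (∀ f → Resolving G f → b ≤ sumF f)

{-# OPTIONS --safe #-}

-- Two sides s = 0, 1, each with hubs u_s - m_s - w_s and K branches; w_0 and w_1 are adjacent, and the edge
-- to be removed is e = u_0 u_1, so that d_{G-e}(u_0, u_1) = 5. A branch consists of two chains of K pairs
-- of adjacent twins, one from u_s through a collar to a vertex p (near), the other from w_s to both p and a further
-- vertex q (far). Every pair of twins costs 1, a total B in both graphs. In G a single broadcast of strength K + 3 at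
-- u_0 separates p from q in all branches at once, since a shortest path to p uses the first chain and one to q
-- must use the second: bdim(G) ≤ B + K + 8. In G - e everything from the other side enters through w_s, which
-- is equidistant from p and q. So each side needs either one extra unit in each of its K branches or
-- one broadcast of strength more than K: bdim(G - e) ≥ B + 2K.

module Submission where

open import Defs
open import Data.Nat using (ℕ; zero; suc; _+_; _*_; _^_; _≤_; _<_; _>_; z≤n; s≤s; s≤s⁻¹; _≤?_; _≤ᵇ_)
open import Data.Nat.Properties
open import Algebra.Properties.CommutativeSemigroup +-commutativeSemigroup using (xy∙z≈xz∙y)
open import Data.Bool using (Bool; true; false; T; if_then_else_; _∨_)
open import Data.Bool.Properties using (T?; T-∧; T-not-≡)
open import Data.Fin as Fin using (Fin; zero; suc; toℕ; fromℕ; fromℕ<; inject₁; combine; remQuot; _↑ˡ_; _↑ʳ_; finToFun; funToFin)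
open import Data.Fin.Patterns using (0F; 1F; 2F)
open import Data.Fin.Properties as Fin using (any?; all?)
open import Data.Sum using (_⊎_; inj₁; inj₂; [_,_]′; swap)
open import Data.Product using (Σ; ∃; _×_; _,_; proj₁; proj₂; uncurry)
open import Function using (_∘_; Equivalence; mk⇔)
open import Relation.Nullary using (¬_; Dec; yes; no; does; contradiction; ¬?; _×-dec_; _⊎-dec_)
open import Relation.Nullary.Decidable using (map′; dec-true; dec-false; does-⇔)
open import Data.Nat.Solver using (module +-*-Solver)
open import Relation.Binary.Definitions using (tri<; tri≈; tri>)
open import Relation.Unary using (Decidable)
open import Relation.Binary.PropositionalEquality using (_≡_; _≗_; refl; cong; cong₂; subst; subst₂; module ≡-Reasoning)
  renaming (sym to ≡-sym; trans to ≡-trans)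

least : {P : ℕ → Set} → Decidable P → ∀ n → P n → ∃ λ m → P m × (∀ k → P k → m ≤ k)
least P? n pn with P? 0
... | yes p0 = 0 , p0 , λ _ _ → z≤n
least P? zero pn | no ¬p0 = contradiction pn ¬p0
least P? (suc n) pn | no ¬p0 with least (P? ∘ suc) n pn
... | m , pm , min = suc m , pm , λ where
  zero p0 → contradiction p0 ¬p0
  (suc k) pk → s≤s (min k pk)

-- Sums over Fin

sumF-cong : ∀ {n} {f g : Fin n → ℕ} → f ≗ g → sumF f ≡ sumF g
sumF-cong {zero} eq = refl
sumF-cong {suc n} eq = cong₂ _+_ (eq zero) (sumF-cong (eq ∘ suc))

sumF-≥ : ∀ {n} {f : Fin n → ℕ} c → (∀ i → c ≤ f i) → n * c ≤ sumF f
sumF-≥ {zero} c c≤f = z≤n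
sumF-≥ {suc n} c c≤f = +-mono-≤ (c≤f zero) (sumF-≥ c (c≤f ∘ suc))

sumF-≥-bump : ∀ {n} {f : Fin n → ℕ} c e → (∀ i → c ≤ f i) → ∀ i → c + e ≤ f i → n * c + e ≤ sumF f
sumF-≥-bump {suc n} c e c≤f zero ce≤ =
  ≤-trans (≤-reflexive (xy∙z≈xz∙y c (n * c) e)) (+-mono-≤ ce≤ (sumF-≥ c (c≤f ∘ suc)))
sumF-≥-bump {suc n} c e c≤f (suc i) ce≤ =
  ≤-trans (≤-reflexive (+-assoc c (n * c) e)) (+-mono-≤ (c≤f zero) (sumF-≥-bump c e (c≤f ∘ suc) i ce≤))

sumF-const : ∀ {n} {f : Fin n → ℕ} c → (∀ i → f i ≡ c) → sumF f ≡ n * c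
sumF-const {zero} c eq = refl
sumF-const {suc n} c eq = cong₂ _+_ (eq zero) (sumF-const c (eq ∘ suc))

sumF-↑ : ∀ {n} m (f : Fin (m + n) → ℕ) → sumF f ≡ sumF (λ i → f (i ↑ˡ n)) + sumF (λ j → f (m ↑ʳ j))
sumF-↑ zero f = refl
sumF-↑ {n} (suc m) f =
  ≡-trans (cong (f zero +_) (sumF-↑ m (f ∘ suc)))
          (≡-sym (+-assoc (f zero) (sumF (λ i → f (suc i ↑ˡ n))) (sumF (λ j → f (suc m ↑ʳ j)))))

sumF-combine : ∀ {n} m (f : Fin (m * n) → ℕ) → sumF f ≡ sumF (λ i → sumF (λ j → f (combine {m} i j)))
sumF-combine zero f = refl
sumF-combine {n} (suc m) f =
  ≡-trans (sumF-↑ n f) (cong (sumF (λ j → f (j ↑ˡ (m * n))) +_) (sumF-combine m (λ j → f (n ↑ʳ j))))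

term≤sumF : ∀ {n} (f : Fin n → ℕ) i → f i ≤ sumF f
term≤sumF f zero = m≤m+n _ _
term≤sumF f (suc i) = ≤-trans (term≤sumF (f ∘ suc) i) (m≤n+m _ _)

-- This is the shape of both `branchTotal` and `sideTotal`: three single entries and a block known
-- to be at least `x`. A surplus `e` adds to `x` wherever it sits, unless it lies in the block,
-- where it must already exceed `x`.
four-≥ : ∀ a b c {d x e} → x ≤ d → e ≤ a ⊎ e ≤ b ⊎ e ≤ c ⊎ x + e ≤ d → x + e ≤ a + (b + (c + d))
four-≥ a b c {d} {x} {e} x≤d (inj₁ e≤a) =
  ≤-trans (≤-reflexive (+-comm x e)) (+-mono-≤ e≤a (m≤n⇒m≤o+n b (m≤n⇒m≤o+n c x≤d)))
four-≥ a b c {d} {x} {e} x≤d (inj₂ (inj₁ e≤b)) =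
  ≤-trans (≤-reflexive (+-comm x e)) (m≤n⇒m≤o+n a (+-mono-≤ e≤b (m≤n⇒m≤o+n c x≤d)))
four-≥ a b c {d} {x} {e} x≤d (inj₂ (inj₂ (inj₁ e≤c))) =
  ≤-trans (≤-reflexive (+-comm x e)) (m≤n⇒m≤o+n a (m≤n⇒m≤o+n b (+-mono-≤ e≤c x≤d)))
four-≥ a b c x≤d (inj₂ (inj₂ (inj₂ xe≤d))) = m≤n⇒m≤o+n a (m≤n⇒m≤o+n b (m≤n⇒m≤o+n c xe≤d))

-- Walks and distances

module _ {n : ℕ} {G : Graph n} where

  edge-sym : ∀ {x y} → Edge G x y → Edge G y x
  edge-sym {x} {y} = subst T (sym G x y)

  infixr 5 _++_
  _++_ : ∀ {x y z k l} → Walk G x y k → Walk G y z l → Walk G x z (k + l)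
  here ++ v = v
  step e w ++ v = step e (w ++ v)

  reverse : ∀ {x y k} → Walk G x y k → Walk G y x k
  reverse here = here
  reverse {k = suc k} (step e w) =
    subst (Walk G _ _) (+-comm k 1) (reverse w ++ step (edge-sym e) here)

  -- With the length fixed, a search over first steps terminates; together with `least` this yields
  -- distances.
  walk? : ∀ x y → Decidable (Walk G x y)
  walk? x y zero = map′ (λ { refl → here }) (λ { here → refl }) (x Fin.≟ y)
  walk? x y (suc k) =
    map′ (λ { (_ , e , w) → step e w }) (λ { (step e w) → _ , e , w })
         (any? (λ z → T? (adj G x z) ×-dec walk? z y k))

  distance : Connected G → ∀ x y → ∃ (IsDist G x y)
  distance conn x y = let k , w = conn x y in least (walk? x y) k w

  lipschitz-walk : (h : Fin n → ℕ) → (∀ x y → Edge G x y → h x ≤ suc (h y)) →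
                   ∀ {x y k} → Walk G x y k → h x ≤ k + h y
  lipschitz-walk h lip here = ≤-refl
  lipschitz-walk h lip (step e w) = ≤-trans (lip _ _ e) (s≤s (lipschitz-walk h lip w))

  -- The walk is cut at the first step that leaves `P`, which has to start at `g`.
  walk-through-gate : {P : Fin n → Set} → Decidable P → ∀ g → (∀ x y → P x → ¬ P y → Edge G x y → x ≡ g) →
                      ∀ {x y k} → P x → ¬ P y → Walk G x y k →
                      ∃ λ i → ∃ λ j → Walk G x g i × Walk G g y j × i + j ≡ k
  walk-through-gate P? g gate px ¬py here = contradiction px ¬py
  walk-through-gate P? g gate px ¬py (step {y = y} e w) with P? y
  ... | no ¬p with refl ← gate _ _ px ¬p e = 0 , _ , here , step e w , refl
  ... | yes p with i , j , u , v , refl ← walk-through-gate P? g gate p ¬py w =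
    suc i , j , step e u , v , refl

  module _ {k : ℕ} {z : Fin n} where

    -- y can be reached from z at least as fast as x, as far as a broadcast of strength k can see
    NoFarther : Fin n → Fin n → Set
    NoFarther y x = ∀ j → j ≤ k → Walk G x z j → ∃ λ i → i ≤ j × Walk G y z i

    -- If one of the two distances is at most `k`, a shortest walk transfers to the other vertex, so
    -- both are, and the transfers make them equal. Otherwise both are truncated to `suc k`.
    truncDist-agree : ∀ {x y s t} → NoFarther y x → NoFarther x y →
                      IsTruncDist G k x z s → IsTruncDist G k y z t → s ≡ t
    truncDist-agree xy yx (d , (w , min) , inj₁ (d≤k , refl)) (d′ , (w′ , min′) , inj₁ (d′≤k , refl)) =
      let i , i≤d , v = xy d d≤k w ; i′ , i′≤d′ , v′ = yx d′ d′≤k w′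
      in ≤-antisym (≤-trans (min _ v′) i′≤d′) (≤-trans (min′ _ v) i≤d)
    truncDist-agree xy yx (d , (w , min) , inj₁ (d≤k , refl)) (d′ , (w′ , min′) , inj₂ (k<d′ , refl)) =
      let i , i≤d , v = xy d d≤k w in contradiction (≤-trans (min′ _ v) (≤-trans i≤d d≤k)) (<⇒≱ k<d′)
    truncDist-agree xy yx (d , (w , min) , inj₂ (k<d , refl)) (d′ , (w′ , min′) , inj₁ (d′≤k , refl)) =
      let i , i≤d′ , v = yx d′ d′≤k w′ in contradiction (≤-trans (min _ v) (≤-trans i≤d′ d′≤k)) (<⇒≱ k<d)
    truncDist-agree xy yx (d , _ , inj₂ (_ , refl)) (d′ , _ , inj₂ (_ , refl)) = refl

    noFarther-refl : ∀ {x} → NoFarther x x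
    noFarther-refl j _ w = j , ≤-refl , w

    noFarther-unreached : ∀ {x y} → (∀ j → Walk G x z j → k < j) → NoFarther y x
    noFarther-unreached far j j≤k w = contradiction j≤k (<⇒≱ (far j w))

  truncDist : Connected G → ∀ k x z → ∃ (IsTruncDist G k x z)
  truncDist conn k x z with distance conn x z
  ... | d , isD with d ≤? k
  ... | yes d≤k = d , d , isD , inj₁ (d≤k , refl)
  ... | no d≰k = suc k , d , isD , inj₂ (≰⇒> d≰k , refl)

  Separates : ℕ → Fin n → Fin n → Fin n → Set
  Separates k z x y = k > 0 × ∃ λ s → ∃ λ t → IsTruncDist G k x z s × IsTruncDist G k y z t × ¬ s ≡ t

  separates-sym : ∀ {k z x y} → Separates k z x y → Separates k z y x
  separates-sym (k>0 , s , t , p , q , s≢t) = k>0 , t , s , q , p , s≢t ∘ ≡-sym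

  -- The distance of `x` is at most `d`, so it survives truncation, while truncating the larger
  -- distance of `y` still leaves a larger value.
  separates : Connected G → ∀ {k z x y d} → k > 0 → d ≤ k →
              Walk G x z d → (∀ j → Walk G y z j → d < j) → Separates k z x y
  separates conn {k} {z} {x} {y} {d} k>0 d≤k w far
    with s , d₁ , isD₁ , c₁ ← truncDist conn k x z | t , d₂ , isD₂ , c₂ ← truncDist conn k y z
    = k>0 , s , t , (d₁ , isD₁ , c₁) , (d₂ , isD₂ , c₂) , s≢t c₁ c₂
    where
    d₁≤d : d₁ ≤ d
    d₁≤d = proj₂ isD₁ d w
    d₁<d₂ : d₁ < d₂
    d₁<d₂ = ≤-<-trans d₁≤d (far d₂ (proj₁ isD₂))
    s≢t : (d₁ ≤ k × s ≡ d₁) ⊎ (k < d₁ × s ≡ suc k) → (d₂ ≤ k × t ≡ d₂) ⊎ (k < d₂ × t ≡ suc k) → ¬ s ≡ t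
    s≢t (inj₁ (_ , refl)) (inj₁ (_ , refl)) s≡t = <⇒≢ d₁<d₂ s≡t
    s≢t (inj₁ (d₁≤k , refl)) (inj₂ (_ , refl)) s≡t = <⇒≢ (s≤s d₁≤k) s≡t
    s≢t (inj₂ (k<d₁ , _)) _ _ = <⇒≱ k<d₁ (≤-trans d₁≤d d≤k)

  separates? : Connected G → ∀ k z x y → Dec (Separates k z x y)
  separates? conn k z x y with truncDist conn k x z | truncDist conn k y z
  ... | s , p | t , q =
    -- Truncated distances are unique, so comparing the two computed values decides the existential.
    (1 ≤? k) ×-dec map′ (λ s≢t → s , t , p , q , s≢t)
      (λ { (s′ , t′ , p′ , q′ , s′≢t′) s≡t → s′≢t′ (≡-trans (unique p′ p) (≡-trans s≡t (unique q q′))) })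
      (¬? (s ≟ t))
    where
    unique : ∀ {x s t} → IsTruncDist G k x z s → IsTruncDist G k x z t → s ≡ t
    unique = truncDist-agree noFarther-refl noFarther-refl

  -- Existence of the broadcast dimension

  resolving-cong : ∀ {f g} → f ≗ g → Resolving G f → Resolving G g
  resolving-cong f≗g res x y x≢y =
    let z , sep = res x y x≢y in z , subst (λ k → Separates k z x y) (f≗g z) sep

  resolving? : Connected G → ∀ f → Dec (Resolving G f)
  resolving? conn f = all? λ x → all? λ y → separated? x y
    where
    separated? : ∀ x y → Dec (¬ x ≡ y → ∃ λ z → Separates (f z) z x y)
    separated? x y with x Fin.≟ y | any? (λ z → separates? conn (f z) z x y)
    ... | yes x≡y | _ = yes (contradiction x≡y)
    ... | no x≢y | yes p = yes (λ _ → p)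
    ... | no x≢y | no ¬p = no (λ h → ¬p (h x≢y))

  self-separates : Connected G → ∀ {k x y} → k > 0 → ¬ x ≡ y → Separates k x x y
  self-separates conn k>0 x≢y =
    separates conn k>0 z≤n here λ { zero here → contradiction refl x≢y ; (suc _) _ → s≤s z≤n }

  ones-resolving : Connected G → Resolving G (λ _ → 1)
  ones-resolving conn x y x≢y = x , self-separates conn (s≤s z≤n) x≢y

  HasBroadcast : ℕ → Set
  HasBroadcast b = ∃ λ f → Resolving G f × sumF f ≡ b

  -- No value of a broadcast of total `b` exceeds `b`, so only finitely many functions need to be
  -- tested, and `Fin (suc b ^ n)` enumerates them. The decoded function agrees with `f` only
  -- pointwise, hence `resolving-cong`.
  hasBroadcast? : Connected G → Decidable HasBroadcast
  hasBroadcast? conn b =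
    map′ (λ (κ , res , eq) → value κ , res , eq) encode (any? λ κ → resolving? conn (value κ) ×-dec (sumF (value κ) ≟ b))
    where
    value : Fin (suc b ^ n) → Fin n → ℕ
    value κ = toℕ ∘ finToFun κ
    encode : HasBroadcast b → ∃ λ κ → Resolving G (value κ) × sumF (value κ) ≡ b
    encode (f , res , eq) =
      funToFin bounded , resolving-cong (≡-sym ∘ value≗f) res , ≡-trans (sumF-cong value≗f) eq
      where
      f<1+b : ∀ z → f z < suc b
      f<1+b z = s≤s (subst (f z ≤_) eq (term≤sumF f z))
      bounded : Fin n → Fin (suc b)
      bounded z = fromℕ< (f<1+b z)
      value≗f : value (funToFin bounded) ≗ f
      value≗f z = ≡-trans (cong toℕ (Fin.finToFun-funToFin bounded z)) (Fin.toℕ-fromℕ< (f<1+b z))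

  bdim-exists : Connected G → ∃ (IsBdim G)
  bdim-exists conn with least (hasBroadcast? conn) _ ((λ _ → 1) , ones-resolving conn , refl)
  ... | b , has , min = b , has , λ f res → min _ (f , res , refl)

-- Edge removal

T-does : {A : Set} (a? : Dec A) → A → T (does a?)
T-does a? a = subst T (≡-sym (dec-true a? a)) _

T-does⁻ : {A : Set} (a? : Dec A) → T (does a?) → A
T-does⁻ (yes a) _ = a

module _ {n : ℕ} {G : Graph n} {u v : Fin n} where

  removeEdge⁺ : ∀ {x y} → Edge G x y → ¬ (x ≡ u × y ≡ v) → ¬ (x ≡ v × y ≡ u) → Edge (removeEdge G u v) x y
  removeEdge⁺ {x} {y} e ≢uv ≢vu =
    Equivalence.from T-∧ (e , Equivalence.from T-not-≡ (cong₂ _∨_ (dec-false ((x Fin.≟ u) ×-dec (y Fin.≟ v)) ≢uv)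
                                                                  (dec-false ((x Fin.≟ v) ×-dec (y Fin.≟ u)) ≢vu)))

  removeEdge⁻ : ∀ {x y} → Edge (removeEdge G u v) x y → Edge G x y × ¬ (x ≡ u × y ≡ v) × ¬ (x ≡ v × y ≡ u)
  removeEdge⁻ {x} {y} e with Equivalence.to (T-∧ {adj G x y}) e
  ... | eG , kept = eG , miss ∘ inj₁ , miss ∘ inj₂
    where
    -- `does hit?` computes to the Boolean test used by `removeEdge`.
    hit? : Dec ((x ≡ u × y ≡ v) ⊎ (x ≡ v × y ≡ u))
    hit? = ((x Fin.≟ u) ×-dec (y Fin.≟ v)) ⊎-dec ((x Fin.≟ v) ×-dec (y Fin.≟ u))
    miss : ¬ ((x ≡ u × y ≡ v) ⊎ (x ≡ v × y ≡ u))
    miss h = subst T (Equivalence.to T-not-≡ kept) (T-does hit? h)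

-- Arcs are directed and edges are not, so a function that bounds distances must satisfy both
-- inequalities.
Close : ℕ → ℕ → Set
Close a b = a ≤ suc b × b ≤ suc a

close! : ∀ a b {_ : T (a ≤ᵇ suc b)} {_ : T (b ≤ᵇ suc a)} → Close a b
close! a b {a≤} {b≤} = ≤ᵇ⇒≤ a (suc b) a≤ , ≤ᵇ⇒≤ b (suc a) b≤

close-refl : ∀ {a b} → a ≡ b → Close a b
close-refl refl = n≤1+n _ , n≤1+n _

close-suc : ∀ {a b} → b ≡ suc a → Close a b
close-suc refl = ≤-trans (n≤1+n _) (n≤1+n _) , ≤-refl

-- Vertices and edges of the construction

module Construction (k : ℕ) where

  K : ℕ
  K = suc k

  -- The places in a branch: `near` is p and `far` is q. In `twin σ t e`, `σ` is 0 for the chain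
  -- from the outer hub and 1 for the chain from the inner hub, `t` counts pairs away from the hub,
  -- and `e` picks a member of the pair.
  data Loc : Set where
    collar near far : Loc
    twin : (σ : Fin 2) (t : Fin K) (e : Fin 2) → Loc

  data V : Set where
    outer middle inner : (s : Fin 2) → V
    br : (s : Fin 2) (i : Fin K) (l : Loc) → V

  -- In `along` the members `e` and `e′` are free: consecutive pairs are completely joined, so that
  -- the members of a pair have the same further neighbours.
  data LocArc : Loc → Loc → Set where
    twins : ∀ {σ t} → LocArc (twin σ t 0F) (twin σ t 1F)
    along : ∀ {σ t t′ e e′} → toℕ t′ ≡ suc (toℕ t) → LocArc (twin σ t e) (twin σ t′ e′)
    to-collar : ∀ {t e} → toℕ t ≡ k → LocArc (twin 0F t e) collar
    collar-near : LocArc collar near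
    to-near : ∀ {t e} → toℕ t ≡ k → LocArc (twin 1F t e) near
    to-far : ∀ {t e} → toℕ t ≡ k → LocArc (twin 1F t e) far

  data First (σ : Fin 2) : Loc → Set where
    first : ∀ {e} → First σ (twin σ zero e)

  -- The Boolean says whether the edge e = u₀u₁ is present.
  data Arc : Bool → V → V → Set where
    chord : Arc true (outer 0F) (outer 1F)
    outer-middle : ∀ {b s} → Arc b (outer s) (middle s)
    middle-inner : ∀ {b s} → Arc b (middle s) (inner s)
    inner-inner : ∀ {b} → Arc b (inner 0F) (inner 1F)
    outer-strand : ∀ {b s i l} → First 0F l → Arc b (outer s) (br s i l)
    inner-strand : ∀ {b s i l} → First 1F l → Arc b (inner s) (br s i l)
    local : ∀ {b s i l l′} → LocArc l l′ → Arc b (br s i l) (br s i l′)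

  Adj : Bool → V → V → Set
  Adj b x y = Arc b x y ⊎ Arc b y x

  locArc? : ∀ l l′ → Dec (LocArc l l′)
  locArc? collar collar = no λ ()
  locArc? collar near = yes collar-near
  locArc? collar far = no λ ()
  locArc? collar (twin _ _ _) = no λ ()
  locArc? near _ = no λ ()
  locArc? far _ = no λ ()
  locArc? (twin 0F t e) collar = map′ to-collar (λ { (to-collar eq) → eq }) (toℕ t ≟ k)
  locArc? (twin 1F t e) collar = no λ ()
  locArc? (twin 0F t e) near = no λ ()
  locArc? (twin 1F t e) near = map′ to-near (λ { (to-near eq) → eq }) (toℕ t ≟ k)
  locArc? (twin 0F t e) far = no λ ()
  locArc? (twin 1F t e) far = map′ to-far (λ { (to-far eq) → eq }) (toℕ t ≟ k)
  locArc? (twin σ t e) (twin σ′ t′ e′) with σ Fin.≟ σ′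
  ... | no σ≢σ′ = no λ { twins → σ≢σ′ refl ; (along _) → σ≢σ′ refl }
  ... | yes refl =
    map′ [ (λ { (refl , refl , refl) → twins }) , along ]′
         (λ { twins → inj₁ (refl , refl , refl) ; (along eq) → inj₂ eq })
         (((t Fin.≟ t′) ×-dec ((e Fin.≟ 0F) ×-dec (e′ Fin.≟ 1F))) ⊎-dec (toℕ t′ ≟ suc (toℕ t)))

  first? : ∀ σ l → Dec (First σ l)
  first? σ collar = no λ ()
  first? σ near = no λ ()
  first? σ far = no λ ()
  first? σ (twin σ′ (suc t) e) = no λ ()
  first? σ (twin σ′ zero e) = map′ (λ { refl → first }) (λ { first → refl }) (σ Fin.≟ σ′)

  arc? : ∀ x y → Dec (Arc true x y)
  arc? (outer 0F) (outer 0F) = no λ ()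
  arc? (outer 0F) (outer 1F) = yes chord
  arc? (outer 1F) (outer s) = no λ ()
  arc? (outer s) (middle s′) = map′ (λ { refl → outer-middle }) (λ { outer-middle → refl }) (s Fin.≟ s′)
  arc? (outer s) (inner s′) = no λ ()
  arc? (outer s) (br s′ i l) =
    map′ (λ { (refl , fst) → outer-strand fst }) (λ { (outer-strand fst) → refl , fst }) ((s Fin.≟ s′) ×-dec first? 0F l)
  arc? (middle s) (outer s′) = no λ ()
  arc? (middle s) (middle s′) = no λ ()
  arc? (middle s) (inner s′) = map′ (λ { refl → middle-inner }) (λ { middle-inner → refl }) (s Fin.≟ s′)
  arc? (middle s) (br s′ i l) = no λ ()
  arc? (inner s) (outer s′) = no λ ()
  arc? (inner s) (middle s′) = no λ ()
  arc? (inner 0F) (inner 0F) = no λ ()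
  arc? (inner 0F) (inner 1F) = yes inner-inner
  arc? (inner 1F) (inner s) = no λ ()
  arc? (inner s) (br s′ i l) =
    map′ (λ { (refl , fst) → inner-strand fst }) (λ { (inner-strand fst) → refl , fst }) ((s Fin.≟ s′) ×-dec first? 1F l)
  arc? (br s i l) (outer s′) = no λ ()
  arc? (br s i l) (middle s′) = no λ ()
  arc? (br s i l) (inner s′) = no λ ()
  arc? (br s i l) (br s′ i′ l′) =
    map′ (λ { (refl , refl , a) → local a }) (λ { (local a) → refl , refl , a })
         ((s Fin.≟ s′) ×-dec ((i Fin.≟ i′) ×-dec locArc? l l′))

  adj? : ∀ x y → Dec (Adj true x y)
  adj? x y = arc? x y ⊎-dec arc? y x

  arc-irrefl : ∀ x → ¬ Arc true x x
  arc-irrefl (br s i (twin σ t e)) (local (along eq)) = 1+n≢n (≡-sym eq)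

  -- Numbering of the vertices

  locSize sideSize size : ℕ
  locSize = 3 + 2 * (K * 2)
  sideSize = 3 + K * locSize
  size = 2 * sideSize

  twinTotal : (V → ℕ) → Fin 2 → Fin K → ℕ
  twinTotal g s i = sumF λ σ → sumF λ t → sumF λ e → g (br s i (twin σ t e))

  branchTotal : (V → ℕ) → Fin 2 → Fin K → ℕ
  branchTotal g s i = g (br s i collar) + (g (br s i near) + (g (br s i far) + twinTotal g s i))

  sideTotal : (V → ℕ) → Fin 2 → ℕ
  sideTotal g s = g (outer s) + (g (middle s) + (g (inner s) + sumF (branchTotal g s)))

  abstract

    encodeLoc : Loc → Fin locSize
    encodeLoc collar = 0F
    encodeLoc near = 1F
    encodeLoc far = 2F
    encodeLoc (twin σ t e) = suc (suc (suc (combine σ (combine t e))))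

    decodeLoc : Fin locSize → Loc
    decodeLoc 0F = collar
    decodeLoc 1F = near
    decodeLoc 2F = far
    decodeLoc (suc (suc (suc x))) = uncurry (λ σ y → uncurry (twin σ) (remQuot 2 y)) (remQuot (K * 2) x)

    encode : V → Fin size
    encode (outer s) = combine {n = sideSize} s 0F
    encode (middle s) = combine {n = sideSize} s 1F
    encode (inner s) = combine {n = sideSize} s 2F
    encode (br s i l) = combine {n = sideSize} s (suc (suc (suc (combine {n = locSize} i (encodeLoc l)))))

    decodeSide : Fin 2 → Fin sideSize → V
    decodeSide s 0F = outer s
    decodeSide s 1F = middle s
    decodeSide s 2F = inner s
    decodeSide s (suc (suc (suc x))) = uncurry (λ i y → br s i (decodeLoc y)) (remQuot locSize x)

    decode : Fin size → V
    decode x = uncurry decodeSide (remQuot sideSize x)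

    decodeLoc-encodeLoc : ∀ l → decodeLoc (encodeLoc l) ≡ l
    decodeLoc-encodeLoc collar = refl
    decodeLoc-encodeLoc near = refl
    decodeLoc-encodeLoc far = refl
    decodeLoc-encodeLoc (twin σ t e) =
      ≡-trans (cong (uncurry λ σ y → uncurry (twin σ) (remQuot 2 y)) (Fin.remQuot-combine {k = K * 2} σ (combine t e)))
              (cong (uncurry (twin σ)) (Fin.remQuot-combine t e))

    encodeLoc-decodeLoc : ∀ x → encodeLoc (decodeLoc x) ≡ x
    encodeLoc-decodeLoc 0F = refl
    encodeLoc-decodeLoc 1F = refl
    encodeLoc-decodeLoc 2F = refl
    encodeLoc-decodeLoc (suc (suc (suc x))) =
      cong (λ y → suc (suc (suc y)))
        (≡-trans (cong (combine (proj₁ (remQuot {2} (K * 2) x)))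
                       (Fin.combine-remQuot {K} 2 (proj₂ (remQuot {2} (K * 2) x))))
                 (Fin.combine-remQuot {2} (K * 2) x))

    decode-encode : ∀ v → decode (encode v) ≡ v
    decode-encode (outer s) = cong (uncurry decodeSide) (Fin.remQuot-combine {k = sideSize} s 0F)
    decode-encode (middle s) = cong (uncurry decodeSide) (Fin.remQuot-combine {k = sideSize} s 1F)
    decode-encode (inner s) = cong (uncurry decodeSide) (Fin.remQuot-combine {k = sideSize} s 2F)
    decode-encode (br s i l) =
      ≡-trans (cong (uncurry decodeSide) (Fin.remQuot-combine {k = sideSize} s (suc (suc (suc (combine {n = locSize} i (encodeLoc l)))))))
      (≡-trans (cong (uncurry λ i y → br s i (decodeLoc y)) (Fin.remQuot-combine {k = locSize} i (encodeLoc l)))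
               (cong (br s i) (decodeLoc-encodeLoc l)))

    encode-decodeSide : ∀ s x → encode (decodeSide s x) ≡ combine {n = sideSize} s x
    encode-decodeSide s 0F = refl
    encode-decodeSide s 1F = refl
    encode-decodeSide s 2F = refl
    encode-decodeSide s (suc (suc (suc x))) =
      cong (λ y → combine s (suc (suc (suc y))))
        (≡-trans (cong (combine (proj₁ (remQuot {K} locSize x)))
                       (encodeLoc-decodeLoc (proj₂ (remQuot {K} locSize x))))
                 (Fin.combine-remQuot {K} locSize x))

    encode-decode : ∀ x → encode (decode x) ≡ x
    encode-decode x =
      ≡-trans (encode-decodeSide (proj₁ (remQuot {2} sideSize x)) (proj₂ (remQuot {2} sideSize x)))
              (Fin.combine-remQuot {2} sideSize x)

    -- The mixed-radix layout of `encode` splits the sum by sides, branches, chains, positions and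
    -- twins. Outside this block the numbering enters only through this identity and the inverse
    -- laws of `encode` and `decode`.
    sumF-sides : ∀ f g → (∀ v → f (encode v) ≡ g v) → sumF f ≡ sumF (sideTotal g)
    sumF-sides f g eq = ≡-trans (sumF-combine {sideSize} 2 f) (sumF-cong sides)
      where
      atTwin : Fin 2 → Fin K → Fin (2 * (K * 2)) → ℕ
      atTwin s i x = f (combine {n = sideSize} s (suc (suc (suc (combine {n = locSize} i (suc (suc (suc x))))))))
      atBranch : Fin 2 → Fin (K * locSize) → ℕ
      atBranch s x = f (combine {n = sideSize} s (suc (suc (suc x))))
      twinTotals : ∀ s i → sumF (atTwin s i) ≡ twinTotal g s i
      twinTotals s i =
        ≡-trans (sumF-combine {K * 2} 2 (atTwin s i)) (sumF-cong λ σ →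
          ≡-trans (sumF-combine {2} K (λ y → atTwin s i (combine {n = K * 2} σ y)))
                  (sumF-cong λ t → sumF-cong λ e → eq (br s i (twin σ t e))))
      branches : ∀ s i → sumF (λ y → atBranch s (combine {n = locSize} i y)) ≡ branchTotal g s i
      branches s i =
        cong₂ _+_ (eq (br s i collar)) (cong₂ _+_ (eq (br s i near)) (cong₂ _+_ (eq (br s i far)) (twinTotals s i)))
      sides : ∀ s → sumF (λ y → f (combine {n = sideSize} s y)) ≡ sideTotal g s
      sides s =
        cong₂ _+_ (eq (outer s)) (cong₂ _+_ (eq (middle s)) (cong₂ _+_ (eq (inner s))
          (≡-trans (sumF-combine {locSize} K (atBranch s)) (sumF-cong (branches s)))))

  encode-injective : ∀ {x y} → encode x ≡ encode y → x ≡ y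
  encode-injective {x} {y} eq = ≡-trans (≡-sym (decode-encode x)) (≡-trans (cong decode eq) (decode-encode y))

  decode-≡ : ∀ {x v} → decode x ≡ v → x ≡ encode v
  decode-≡ {x} refl = ≡-sym (encode-decode x)

  -- The graphs G and G - e

  G : Graph size
  G = record
    { adj = λ x y → does (adj? (decode x) (decode y))
    ; sym = λ x y → does-⇔ (mk⇔ swap swap) (adj? (decode x) (decode y)) (adj? (decode y) (decode x))
    ; irrefl = λ x → dec-false (adj? (decode x) (decode x)) [ arc-irrefl _ , arc-irrefl _ ]′
    }

  u₀ u₁ : Fin size
  u₀ = encode (outer 0F)
  u₁ = encode (outer 1F)

  Γ : Bool → Graph size
  Γ true = G
  Γ false = removeEdge G u₀ u₁

  arc-lift : ∀ {x y} → Arc false x y → Arc true x y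
  arc-lift outer-middle = outer-middle
  arc-lift middle-inner = middle-inner
  arc-lift inner-inner = inner-inner
  arc-lift (outer-strand fst) = outer-strand fst
  arc-lift (inner-strand fst) = inner-strand fst
  arc-lift (local a) = local a

  arc-drop : ∀ {x y} → Arc true x y → ¬ (x ≡ outer 0F × y ≡ outer 1F) → Arc false x y
  arc-drop chord ≢e = contradiction (refl , refl) ≢e
  arc-drop outer-middle _ = outer-middle
  arc-drop middle-inner _ = middle-inner
  arc-drop inner-inner _ = inner-inner
  arc-drop (outer-strand fst) _ = outer-strand fst
  arc-drop (inner-strand fst) _ = inner-strand fst
  arc-drop (local a) _ = local a

  arc-no-chord : ∀ {x y} → Arc false x y → ¬ (x ≡ outer 0F × y ≡ outer 1F) × ¬ (x ≡ outer 1F × y ≡ outer 0F)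
  arc-no-chord outer-middle = (λ ()) , (λ ())
  arc-no-chord middle-inner = (λ ()) , (λ ())
  arc-no-chord inner-inner = (λ ()) , (λ ())
  arc-no-chord (outer-strand _) = (λ ()) , (λ ())
  arc-no-chord (inner-strand _) = (λ ()) , (λ ())
  arc-no-chord (local _) = (λ ()) , (λ ())

  G-edge : ∀ {x y} → Adj true x y → Edge G (encode x) (encode y)
  G-edge {x} {y} a = T-does (adj? _ _) (subst₂ (Adj true) (≡-sym (decode-encode x)) (≡-sym (decode-encode y)) a)

  -- `edge` and `edge⁻` identify `removeEdge` with the loss of the single constructor `chord`, so
  -- that both graphs can be treated uniformly through `Adj b`.
  edge : ∀ {b x y} → Adj b x y → Edge (Γ b) (encode x) (encode y)
  edge {true} a = G-edge a
  edge {false} (inj₁ a) =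
    removeEdge⁺ {G = G} (G-edge (inj₁ (arc-lift a)))
      (λ (p , q) → proj₁ (arc-no-chord a) (encode-injective p , encode-injective q))
      (λ (p , q) → proj₂ (arc-no-chord a) (encode-injective p , encode-injective q))
  edge {false} (inj₂ a) =
    removeEdge⁺ {G = G} (G-edge (inj₂ (arc-lift a)))
      (λ (p , q) → proj₂ (arc-no-chord a) (encode-injective q , encode-injective p))
      (λ (p , q) → proj₁ (arc-no-chord a) (encode-injective q , encode-injective p))

  edge⁻ : ∀ {b x y} → Edge (Γ b) x y → Adj b (decode x) (decode y)
  edge⁻ {true} e = T-does⁻ (adj? _ _) e
  edge⁻ {false} {x} {y} e with removeEdge⁻ {G = G} e
  ... | eG , ≢uv , ≢vu with T-does⁻ (adj? (decode x) (decode y)) eG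
  ... | inj₁ a = inj₁ (arc-drop a λ (p , q) → ≢uv (decode-≡ p , decode-≡ q))
  ... | inj₂ a = inj₂ (arc-drop a λ (p , q) → ≢vu (decode-≡ q , decode-≡ p))

  hub : Fin 2 → Fin 2 → V
  hub 0F = outer
  hub 1F = inner

  side : V → Fin 2
  side (outer s) = s
  side (middle s) = s
  side (inner s) = s
  side (br s i l) = s

  -- Explicit walks and connectedness

  module Walks (b : Bool) where

    W : V → V → ℕ → Set
    W x y = Walk (Γ b) (encode x) (encode y)

    infixr 5 _∷_
    _∷_ : ∀ {x y z j} → Adj b x y → W y z j → W x z (suc j)
    a ∷ v = step (edge {b} a) v

    hub-strand : ∀ σ {s i l} → First σ l → Adj b (hub σ s) (br s i l)
    hub-strand 0F fst = inj₁ (outer-strand fst)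
    hub-strand 1F fst = inj₁ (inner-strand fst)

    strand-walk : ∀ s i σ t e → W (br s i (twin σ t e)) (hub σ s) (suc (toℕ t))
    strand-walk s i σ t e = go (toℕ t) t e refl
      where
      -- The recursion is on the value of `t`, because the preceding index `inject₁ t` is not a
      -- subterm of `suc t`.
      go : ∀ n t e → toℕ t ≡ n → W (br s i (twin σ t e)) (hub σ s) (suc n)
      go zero zero e refl = swap (hub-strand σ first) ∷ here
      go (suc n) (suc t) e eq =
        inj₂ (local (along (cong suc (≡-sym (Fin.toℕ-inject₁ t)))))
        ∷ go n (inject₁ t) 0F (≡-trans (Fin.toℕ-inject₁ t) (suc-injective eq))

    last-walk : ∀ s i σ → W (br s i (twin σ (fromℕ k) 0F)) (hub σ s) K
    last-walk s i σ = subst (λ j → W (br s i (twin σ (fromℕ k) 0F)) (hub σ s) (suc j)) (Fin.toℕ-fromℕ k) (strand-walk s i σ (fromℕ k) 0F)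

    near-outer : ∀ s i → W (br s i near) (outer s) (2 + K)
    near-outer s i = inj₂ (local collar-near) ∷ inj₂ (local (to-collar (Fin.toℕ-fromℕ k))) ∷ last-walk s i 0F

    near-inner : ∀ s i → W (br s i near) (inner s) (1 + K)
    near-inner s i = inj₂ (local (to-near (Fin.toℕ-fromℕ k))) ∷ last-walk s i 1F

    -- As long as `near-inner`: seen from the inner hub, p and q look alike.
    far-inner : ∀ s i → W (br s i far) (inner s) (1 + K)
    far-inner s i = inj₂ (local (to-far (Fin.toℕ-fromℕ k))) ∷ last-walk s i 1F

    outer-inner : ∀ s → W (outer s) (inner s) 2
    outer-inner s = inj₁ outer-middle ∷ inj₁ middle-inner ∷ here

    to-inner : ∀ x → ∃ (W x (inner (side x)))
    to-inner (outer s) = _ , outer-inner s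
    to-inner (middle s) = _ , inj₁ middle-inner ∷ here
    to-inner (inner s) = _ , here
    to-inner (br s i collar) = _ , inj₁ (local collar-near) ∷ near-inner s i
    to-inner (br s i near) = _ , near-inner s i
    to-inner (br s i far) = _ , far-inner s i
    to-inner (br s i (twin 0F t e)) = _ , strand-walk s i 0F t e ++ outer-inner s
    to-inner (br s i (twin 1F t e)) = _ , strand-walk s i 1F t e

    inners : ∀ s s′ → ∃ (W (inner s) (inner s′))
    inners 0F 0F = _ , here
    inners 0F 1F = _ , inj₁ inner-inner ∷ here
    inners 1F 0F = _ , inj₂ inner-inner ∷ here
    inners 1F 1F = _ , here

    -- A walk between encoded vertices cannot be matched on directly, since `encode` does not
    -- reduce; `first-step` generalises the endpoints and the result is decoded.
    uncons : ∀ {x z j} → W x z j → x ≡ z ⊎ ∃ λ y → ∃ λ i → Adj b x y × W y z i × j ≡ suc i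
    uncons {x} {z} v with first-step v
      where
      first-step : ∀ {x z j} → Walk (Γ b) x z j →
                   x ≡ z ⊎ ∃ λ y → ∃ λ i → Edge (Γ b) x y × Walk (Γ b) y z i × j ≡ suc i
      first-step here = inj₁ refl
      first-step (step e v) = inj₂ (_ , _ , e , v , refl)
    ... | inj₁ x≡z = inj₁ (encode-injective x≡z)
    ... | inj₂ (y , i , e , v′ , eq) =
      inj₂ (decode y , i , subst (λ x → Adj b x (decode y)) (decode-encode x) (edge⁻ {b} e) ,
            subst (λ y → Walk (Γ b) y (encode z) i) (≡-sym (encode-decode y)) v′ , eq)

    connected : Connected (Γ b)
    connected x y = subst₂ (λ x y → ∃ (Walk (Γ b) x y)) (encode-decode x) (encode-decode y) (join (decode x) (decode y))
      where
      join : ∀ x y → ∃ (W x y)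
      join x y =
        _ , proj₂ (to-inner x) ++ proj₂ (inners (side x) (side y)) ++ reverse (proj₂ (to-inner y))

    potential : ∀ (h : V → ℕ) → (∀ {x y} → Arc b x y → Close (h x) (h y)) →
                ∀ {x y j} → W x y j → h x ≤ j + h y
    potential h close {x} {y} {j} v =
      subst₂ (λ x y → h x ≤ j + h y) (decode-encode x) (decode-encode y)
        (lipschitz-walk (h ∘ decode) (λ _ _ e → [ proj₁ ∘ close , proj₂ ∘ close ]′ (edge⁻ {b} e)) v)

  module G₁ = Walks true
  module G₀ = Walks false

  -- Lower bounds on distances, via functions changing by at most one along edges

  locDepth : Loc → ℕ
  locDepth (twin σ t e) = suc (toℕ t)
  locDepth _ = suc K

  locDepth-first : ∀ {σ l} → First σ l → locDepth l ≡ 1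
  locDepth-first first = refl

  locDepth-close : ∀ {l l′} → LocArc l l′ → Close (locDepth l) (locDepth l′)
  locDepth-close twins = close-refl refl
  locDepth-close (along eq) = close-suc (cong suc eq)
  locDepth-close (to-collar eq) = close-suc (cong (λ j → 2 + j) (≡-sym eq))
  locDepth-close collar-near = close-refl refl
  locDepth-close (to-near eq) = close-suc (cong (λ j → 2 + j) (≡-sym eq))
  locDepth-close (to-far eq) = close-suc (cong (λ j → 2 + j) (≡-sym eq))

  sameBranch? : (s : Fin 2) (i : Fin K) (s′ : Fin 2) (i′ : Fin K) → Dec (s′ ≡ s × i′ ≡ i)
  sameBranch? s i s′ i′ = (s′ Fin.≟ s) ×-dec (i′ Fin.≟ i)

  -- Within branch `i` of side `s` this is the distance to the nearest hub. It is `suc K` at both p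
  -- and q, so a broadcast of strength `K` or less from outside the branch reaches neither.
  depth : Fin 2 → Fin K → V → ℕ
  depth s i (br s′ i′ l) = if does (sameBranch? s i s′ i′) then locDepth l else 0
  depth s i _ = 0

  depth-close : ∀ s i {x y} → Arc false x y → Close (depth s i x) (depth s i y)
  depth-close s i outer-middle = close! 0 0
  depth-close s i middle-inner = close! 0 0
  depth-close s i inner-inner = close! 0 0
  depth-close s i (outer-strand {s = s′} {i′} fst) with does (sameBranch? s i s′ i′)
  ... | true = close-suc (locDepth-first fst)
  ... | false = close! 0 0
  depth-close s i (inner-strand {s = s′} {i′} fst) with does (sameBranch? s i s′ i′)
  ... | true = close-suc (locDepth-first fst)
  ... | false = close! 0 0
  depth-close s i (local {s = s′} {i′} a) with does (sameBranch? s i s′ i′)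
  ... | true = locDepth-close a
  ... | false = close! 0 0

  depth-in : ∀ s i l → depth s i (br s i l) ≡ locDepth l
  depth-in s i l = cong (if_then locDepth l else 0) (dec-true (sameBranch? s i s i) (refl , refl))

  depth-out : ∀ s i s′ i′ l → ¬ (s′ ≡ s × i′ ≡ i) → depth s i (br s′ i′ l) ≡ 0
  depth-out s i s′ i′ l ≢ = cong (if_then locDepth l else 0) (dec-false (sameBranch? s i s′ i′) ≢)

  outward : ∀ s i {l z j} → depth s i z ≡ 0 → G₀.W (br s i l) z j → locDepth l ≤ j
  outward s i {l} {z} {j} z0 v =
    subst₂ _≤_ (depth-in s i l) (≡-trans (cong (j +_) z0) (+-identityʳ j)) (G₀.potential (depth s i) (depth-close s i) v)

  -- The position on the hub path from u₀ to u₁. A branch touches the outer and the inner hub of its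
  -- side, so all of it gets the level of the middle hub between them.
  span : V → ℕ
  span (outer 0F) = 0
  span (middle 0F) = 1
  span (inner 0F) = 2
  span (inner 1F) = 3
  span (middle 1F) = 4
  span (outer 1F) = 5
  span (br 0F i l) = 1
  span (br 1F i l) = 4

  span-close : ∀ {x y} → Arc false x y → Close (span x) (span y)
  span-close (outer-middle {s = 0F}) = close! 0 1
  span-close (outer-middle {s = 1F}) = close! 5 4
  span-close (middle-inner {s = 0F}) = close! 1 2
  span-close (middle-inner {s = 1F}) = close! 4 3
  span-close inner-inner = close! 2 3
  span-close (outer-strand {s = 0F} fst) = close! 0 1
  span-close (outer-strand {s = 1F} fst) = close! 5 4
  span-close (inner-strand {s = 0F} fst) = close! 2 1
  span-close (inner-strand {s = 1F} fst) = close! 3 4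
  span-close (local {s = 0F} a) = close! 1 1
  span-close (local {s = 1F} a) = close! 4 4

  outer-distance : IsDist (Γ false) u₀ u₁ 5
  outer-distance =
    G₀.outer-inner 0F ++ inj₁ inner-inner G₀.∷ reverse (G₀.outer-inner 1F) ,
    -- `span` is 5 at u₁ and 0 at u₀, so the bound is read off the reversed walk.
    λ j v → subst (5 ≤_) (+-identityʳ j) (G₀.potential span span-close (reverse {G = Γ false} v))

  -- reach s i bounds distances in G from the outer hub of the side other than s; δ accounts for crossing the chord.

  δ : Fin 2 → Fin 2 → ℕ
  δ s s′ = if does (s′ Fin.≟ s) then 1 else 0

  -- The first chain starts at 2, after the chord and one step, and leads to p at `3 + K`. The
  -- vertex q hangs on the second chain alone, which starts at 4, and comes one later.
  locReach : Loc → ℕ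
  locReach (twin 0F t e) = 2 + toℕ t
  locReach collar = 2 + K
  locReach near = 3 + K
  locReach far = 4 + K
  locReach (twin 1F t e) = 4 + toℕ t

  reach : Fin 2 → Fin K → V → ℕ
  reach s i (outer s′) = δ s s′
  reach s i (middle s′) = 1 + δ s s′
  reach s i (inner s′) = 2 + δ s s′
  reach s i (br s′ i′ l) = if does (sameBranch? s i s′ i′) then locReach l else 1 + δ s s′

  locReach-close : ∀ {l l′} → LocArc l l′ → Close (locReach l) (locReach l′)
  locReach-close (twins {0F}) = close-refl refl
  locReach-close (twins {1F}) = close-refl refl
  locReach-close (along {0F} eq) = close-suc (cong (2 +_) eq)
  locReach-close (along {1F} eq) = close-suc (cong (4 +_) eq)
  locReach-close (to-collar eq) = close-suc (cong (3 +_) (≡-sym eq))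
  locReach-close collar-near = close-suc refl
  locReach-close (to-near eq) = close-refl (cong (4 +_) eq)
  locReach-close (to-far eq) = close-suc (cong (5 +_) (≡-sym eq))

  δ-self : ∀ s → δ s s ≡ 1
  δ-self s = cong (if_then 1 else 0) (dec-true (s Fin.≟ s) refl)

  reach-close : ∀ s i {x y} → Arc true x y → Close (reach s i x) (reach s i y)
  reach-close 0F i chord = close! 1 0
  reach-close 1F i chord = close! 0 1
  reach-close s i outer-middle = close-suc refl
  reach-close s i middle-inner = close-suc refl
  reach-close 0F i inner-inner = close! 3 2
  reach-close 1F i inner-inner = close! 2 3
  reach-close s i (outer-strand {s = s′} {i = i′} {l} fst) =
    subst (Close (δ s s′)) (≡-sym (entry (sameBranch? s i s′ i′) fst)) (close-suc refl)
    where
    entry : (same? : Dec (s′ ≡ s × i′ ≡ i)) → First 0F l → (if does same? then locReach l else 1 + δ s s′) ≡ 1 + δ s s′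
    entry (yes (refl , refl)) first = cong suc (≡-sym (δ-self s))
    entry (no _) _ = refl
  reach-close s i (inner-strand {s = s′} {i = i′} {l} fst) = entry (sameBranch? s i s′ i′) fst
    where
    entry : (same? : Dec (s′ ≡ s × i′ ≡ i)) → First 1F l → Close (2 + δ s s′) (if does same? then locReach l else 1 + δ s s′)
    entry (yes (refl , refl)) first = close-suc (cong (3 +_) (≡-sym (δ-self s)))
    entry (no _) _ = ≤-refl , ≤-trans (n≤1+n _) (n≤1+n _)
  reach-close s i (local {s = s′} {i′} a) with does (sameBranch? s i s′ i′)
  ... | true = locReach-close a
  ... | false = close-refl refl

  -- This gives `3 + K` for the outer hub of the same side and `4 + K` for the opposite one, in both
  -- cases one more than the walk from p through the first chain.
  far-outer : ∀ s i s′ {j} → G₁.W (br s i far) (outer s′) j → 4 + K ≤ j + δ s s′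
  far-outer s i s′ {j} v = subst (_≤ j + δ s s′) reach-far (G₁.potential (reach s i) (reach-close s i) v)
    where
    reach-far : reach s i (br s i far) ≡ 4 + K
    reach-far = cong (if_then 4 + K else 1 + δ s s) (dec-true (sameBranch? s i s i) (refl , refl))

  -- Lower bound for bdim(G - e)

  _≟V_ : (x y : V) → Dec (x ≡ y)
  x ≟V y = map′ encode-injective (cong encode) (encode x Fin.≟ encode y)

  -- The forced cost of the twins of one branch, in the shape that nested uses of `sumF-≥` produce.
  τ : ℕ
  τ = 2 * (K * 1)

  module LowerBound (f : Fin size → ℕ) (res : Resolving (Γ false) f) where

    g : V → ℕ
    g = f ∘ encode

    NF : V → V → V → Set
    NF z y x = NoFarther {G = Γ false} {g z} {encode z} (encode y) (encode x)

    -- The form in which resolvability is used: a vertex is ruled out as a resolver by showing `NF`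
    -- in both directions.
    resolver : ∀ x y → ¬ x ≡ y → ∃ λ z → g z > 0 × ¬ (NF z y x × NF z x y)
    resolver x y x≢y with res (encode x) (encode y) (x≢y ∘ encode-injective)
    ... | z , g>0 , s , t , p , q , s≢t
      with ez ← encode-decode z =
      decode z , subst (λ z → f z > 0) (≡-sym ez) g>0 ,
      λ (yx , xy) → s≢t (truncDist-agree (transport yx) (transport xy) p q)
      where
      transport : ∀ {x y} → NF (decode z) y x → NoFarther {G = Γ false} {f z} {z} (encode y) (encode x)
      transport {x} {y} = subst (λ z → NoFarther {G = Γ false} {f z} {z} (encode y) (encode x)) (encode-decode z)

    twin-swap : ∀ {s i σ t e} e′ {y} → Adj false (br s i (twin σ t e)) y →
                y ≡ br s i (twin σ t e′) ⊎ Adj false (br s i (twin σ t e′)) y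
    twin-swap 0F (inj₁ (local twins)) = inj₂ (inj₁ (local twins))
    twin-swap 1F (inj₁ (local twins)) = inj₁ refl
    twin-swap _ (inj₁ (local (along eq))) = inj₂ (inj₁ (local (along eq)))
    twin-swap _ (inj₁ (local (to-collar eq))) = inj₂ (inj₁ (local (to-collar eq)))
    twin-swap _ (inj₁ (local (to-near eq))) = inj₂ (inj₁ (local (to-near eq)))
    twin-swap _ (inj₁ (local (to-far eq))) = inj₂ (inj₁ (local (to-far eq)))
    twin-swap _ (inj₂ (outer-strand first)) = inj₂ (inj₂ (outer-strand first))
    twin-swap _ (inj₂ (inner-strand first)) = inj₂ (inj₂ (inner-strand first))
    twin-swap 0F (inj₂ (local twins)) = inj₁ refl
    twin-swap 1F (inj₂ (local twins)) = inj₂ (inj₂ (local twins))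
    twin-swap _ (inj₂ (local (along eq))) = inj₂ (inj₂ (local (along eq)))

    -- The first vertex of the walk is replaced by its twin; if the walk steps to that twin at once,
    -- the first step is dropped instead.
    twin-noFarther : ∀ {s i σ t z} e e′ → ¬ br s i (twin σ t e) ≡ z →
                     NF z (br s i (twin σ t e′)) (br s i (twin σ t e))
    twin-noFarther e e′ ≢z j _ v with G₀.uncons v
    ... | inj₁ ≡z = contradiction ≡z ≢z
    ... | inj₂ (y , i , a , v′ , refl) with twin-swap e′ a
    ... | inj₁ refl = i , n≤1+n i , v′
    ... | inj₂ a′ = suc i , ≤-refl , a′ G₀.∷ v′

    -- Only a twin itself can tell the two apart, so one of them broadcasts.
    twins-forced : ∀ s i σ t → 1 ≤ sumF λ e → g (br s i (twin σ t e))
    twins-forced s i σ t with resolver (br s i (twin σ t 0F)) (br s i (twin σ t 1F)) (λ ())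
    ... | z , g>0 , disagree with br s i (twin σ t 0F) ≟V z | br s i (twin σ t 1F) ≟V z
    ... | yes refl | _ = ≤-trans g>0 (term≤sumF (λ e → g (br s i (twin σ t e))) 0F)
    ... | no _ | yes refl = ≤-trans g>0 (term≤sumF (λ e → g (br s i (twin σ t e))) 1F)
    ... | no ≢0 | no ≢1 = contradiction (twin-noFarther 0F 1F ≢0 , twin-noFarther 1F 0F ≢1) disagree

    τ≤twinTotal : ∀ s i → τ ≤ twinTotal g s i
    τ≤twinTotal s i = sumF-≥ (K * 1) λ σ → sumF-≥ 1 (twins-forced s i σ)

    τ≤branchTotal : ∀ s i → τ ≤ branchTotal g s i
    τ≤branchTotal s i =
      m≤n⇒m≤o+n (g (br s i collar)) (m≤n⇒m≤o+n (g (br s i near)) (m≤n⇒m≤o+n (g (br s i far)) (τ≤twinTotal s i)))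

    -- The part of a broadcast at this place that may already be charged to `τ`.
    weight : Loc → ℕ
    weight (twin _ _ _) = 1
    weight _ = 0

    branchTotal-excess : ∀ s i l e → weight l + e ≤ g (br s i l) → τ + e ≤ branchTotal g s i
    branchTotal-excess s i l e h = four-≥ (g (br s i collar)) (g (br s i near)) (g (br s i far)) (τ≤twinTotal s i) (excess l h)
      where
      excess : ∀ l → weight l + e ≤ g (br s i l) →
               e ≤ g (br s i collar) ⊎ e ≤ g (br s i near) ⊎ e ≤ g (br s i far) ⊎ τ + e ≤ twinTotal g s i
      excess collar h = inj₁ h
      excess near h = inj₂ (inj₁ h)
      excess far h = inj₂ (inj₂ (inj₁ h))
      excess (twin σ t e′) h = inj₂ (inj₂ (inj₂
        (sumF-≥-bump (K * 1) e (λ σ → sumF-≥ 1 (twins-forced s i σ)) σ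
          (sumF-≥-bump 1 e (twins-forced s i σ) t
            (≤-trans h (term≤sumF (λ e → g (br s i (twin σ t e))) e′))))))

    -- With the chord gone, the edge between the inner hubs is the only one joining the sides.
    gate : ∀ s x y → side (decode x) ≡ s → ¬ side (decode y) ≡ s → Edge (Γ false) x y → x ≡ encode (inner s)
    gate s x y xs y≢s e = decode-≡ (gateV xs y≢s (edge⁻ {false} e))
      where
      gateV : ∀ {x y} → side x ≡ s → ¬ side y ≡ s → Adj false x y → x ≡ inner s
      gateV refl ≢ (inj₁ outer-middle) = contradiction refl ≢
      gateV refl ≢ (inj₁ middle-inner) = contradiction refl ≢
      gateV refl ≢ (inj₁ inner-inner) = refl
      gateV refl ≢ (inj₁ (outer-strand _)) = contradiction refl ≢
      gateV refl ≢ (inj₁ (inner-strand _)) = contradiction refl ≢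
      gateV refl ≢ (inj₁ (local _)) = contradiction refl ≢
      gateV refl ≢ (inj₂ outer-middle) = contradiction refl ≢
      gateV refl ≢ (inj₂ middle-inner) = contradiction refl ≢
      gateV refl ≢ (inj₂ inner-inner) = refl
      gateV refl ≢ (inj₂ (outer-strand _)) = contradiction refl ≢
      gateV refl ≢ (inj₂ (inner-strand _)) = contradiction refl ≢
      gateV refl ≢ (inj₂ (local _)) = contradiction refl ≢

    -- A walk to the other side passes `inner s`, after at least `locDepth l` steps; that initial
    -- part is exchanged for the given walk from `l′`.
    gate-noFarther : ∀ {s i z l l′} → ¬ side z ≡ s → G₀.W (br s i l′) (inner s) (locDepth l) →
                     NF z (br s i l′) (br s i l)
    gate-noFarther {s} {i} {z} {l} {l′} z≢s w′ j _ v
      with walk-through-gate {P = λ x → side (decode x) ≡ s} (λ x → side (decode x) Fin.≟ s)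
             (encode (inner s)) (gate s) (cong side (decode-encode (br s i l)))
             (z≢s ∘ ≡-trans (≡-sym (cong side (decode-encode z)))) v
    ... | j₁ , j₂ , v₁ , v₂ , refl = _ , +-monoˡ-≤ j₂ (outward s i refl v₁) , w′ ++ v₂

    -- Strength one detects nothing beyond adjacency.
    1-noFarther : ∀ {s i σ t e l l′} → (¬ br s i l ≡ br s i (twin σ t e)) → g (br s i (twin σ t e)) ≤ 1 →
                  (Adj false (br s i l) (br s i (twin σ t e)) → Adj false (br s i l′) (br s i (twin σ t e))) →
                  NF (br s i (twin σ t e)) (br s i l′) (br s i l)
    1-noFarther ≢z g≤1 adj⇒ j j≤g v with G₀.uncons v
    ... | inj₁ ≡z = contradiction ≡z ≢z
    ... | inj₂ (y , suc i , _ , _ , refl) = contradiction (≤-trans j≤g g≤1) λ { (s≤s ()) }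
    ... | inj₂ (y , zero , a , v′ , refl) with G₀.uncons v′
    ... | inj₁ refl = 1 , ≤-refl , adj⇒ a G₀.∷ here
    ... | inj₂ (_ , _ , _ , _ , ())

    unreached : ∀ {s i z l l′} → depth s i z ≡ 0 → g z < locDepth l → NF z (br s i l′) (br s i l)
    unreached d0 g< = noFarther-unreached λ j v → <-≤-trans g< (outward _ _ d0 v)

    near⇒far : ∀ {s i σ t e} → Adj false (br s i near) (br s i (twin σ t e)) → Adj false (br s i far) (br s i (twin σ t e))
    near⇒far (inj₁ (local ()))
    near⇒far (inj₂ (local (to-near eq))) = inj₂ (local (to-far eq))

    far⇒near : ∀ {s i σ t e} → Adj false (br s i far) (br s i (twin σ t e)) → Adj false (br s i near) (br s i (twin σ t e))
    far⇒near (inj₁ (local ()))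
    far⇒near (inj₂ (local (to-far eq))) = inj₂ (local (to-near eq))

    -- The resolver of p and q lies on side `s` by the gate. With strength at most `K` it would not
    -- reach p or q from outside the branch; inside, a frugal branch offers only twins of strength
    -- 1, each adjacent to both p and q or to neither.
    strong-broadcast : ∀ s i → branchTotal g s i ≤ τ → ∃ λ z → side z ≡ s × K < g z
    strong-broadcast s i frugal = let z , g>0 , disagree = resolver (br s i near) (br s i far) (λ ()) in locate z g>0 disagree
      where
      -- Frugality leaves nothing beyond the forced units: the collar, p and q are silent and no
      -- twin exceeds 1.
      not-excessive : ∀ l → ¬ suc (weight l) ≤ g (br s i l)
      not-excessive l h = <⇒≱ (≤-trans (≤-reflexive (+-comm 1 τ)) (branchTotal-excess s i l 1 (≤-trans (≤-reflexive (+-comm (weight l) 1)) h))) frugal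
      outside : ∀ z → depth s i z ≡ 0 → g z < suc K → NF z (br s i far) (br s i near) × NF z (br s i near) (br s i far)
      outside z d0 g≤K = unreached d0 g≤K , unreached d0 g≤K
      weak : ∀ z → side z ≡ s → g z > 0 → g z < suc K → NF z (br s i far) (br s i near) × NF z (br s i near) (br s i far)
      weak (outer _) _ _ g≤K = outside _ refl g≤K
      weak (middle _) _ _ g≤K = outside _ refl g≤K
      weak (inner _) _ _ g≤K = outside _ refl g≤K
      weak (br s′ i′ l) z∈s g>0 g≤K with sameBranch? s i s′ i′
      weak (br s′ i′ l) z∈s g>0 g≤K | no ≢ = outside _ (depth-out s i s′ i′ l ≢) g≤K
      weak (br s′ i′ collar) z∈s g>0 g≤K | yes (refl , refl) = contradiction g>0 (not-excessive collar)
      weak (br s′ i′ near) z∈s g>0 g≤K | yes (refl , refl) = contradiction g>0 (not-excessive near)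
      weak (br s′ i′ far) z∈s g>0 g≤K | yes (refl , refl) = contradiction g>0 (not-excessive far)
      weak (br s′ i′ (twin σ t e)) z∈s g>0 g≤K | yes (refl , refl) =
        1-noFarther (λ ()) g≤1 near⇒far , 1-noFarther (λ ()) g≤1 far⇒near
        where
        g≤1 : g (br s i (twin σ t e)) ≤ 1
        g≤1 = s≤s⁻¹ (≰⇒> (not-excessive (twin σ t e)))
      locate : ∀ z → g z > 0 → ¬ (NF z (br s i far) (br s i near) × NF z (br s i near) (br s i far)) →
               ∃ λ z → side z ≡ s × K < g z
      locate z g>0 disagree with side z Fin.≟ s | suc K ≤? g z
      ... | yes z∈s | yes K<g = z , z∈s , K<g
      ... | no z∉s | _ = contradiction (gate-noFarther z∉s (G₀.far-inner s i) , gate-noFarther z∉s (G₀.near-inner s i)) disagree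
      ... | yes z∈s | no K≮g = contradiction (weak z z∈s g>0 (≰⇒> K≮g)) disagree

    -- Either every branch spends more than `τ`, which gives `K` extra units, or a frugal branch
    -- forces one strong broadcast on the side, worth `K` extra units by itself.
    sideTotal-≥ : ∀ s → K * τ + K ≤ sideTotal g s
    sideTotal-≥ s =
      four-≥ (g (outer s)) (g (middle s)) (g (inner s)) (sumF-≥ τ (τ≤branchTotal s))
        (excess (any? λ i → branchTotal g s i ≤? τ))
      where
      Excess : Set
      Excess = K ≤ g (outer s) ⊎ K ≤ g (middle s) ⊎ K ≤ g (inner s) ⊎ K * τ + K ≤ sumF (branchTotal g s)
      -- The strict bound `K < g z` pays for the one unit that a twin may already owe to `τ`.
      weight+K≤ : ∀ l → weight l + K ≤ suc K
      weight+K≤ collar = n≤1+n K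
      weight+K≤ near = n≤1+n K
      weight+K≤ far = n≤1+n K
      weight+K≤ (twin _ _ _) = ≤-refl
      at : ∀ z → side z ≡ s → K < g z → Excess
      at (outer _) refl K<g = inj₁ (<⇒≤ K<g)
      at (middle _) refl K<g = inj₂ (inj₁ (<⇒≤ K<g))
      at (inner _) refl K<g = inj₂ (inj₂ (inj₁ (<⇒≤ K<g)))
      at (br _ i l) refl K<g = inj₂ (inj₂ (inj₂
        (sumF-≥-bump τ K (τ≤branchTotal s) i (branchTotal-excess s i l K (≤-trans (weight+K≤ l) K<g)))))
      excess : Dec (∃ λ i → branchTotal g s i ≤ τ) → Excess
      excess (yes (i , frugal)) = let z , z∈s , K<g = strong-broadcast s i frugal in at z z∈s K<g
      excess (no none) = inj₂ (inj₂ (inj₂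
        (≤-trans (≤-reflexive (≡-trans (+-comm (K * τ) K) (≡-sym (*-suc K τ))))
                 (sumF-≥ (suc τ) λ i → ≰⇒> λ frugal → none (i , frugal)))))

    sumF-≥-sides : 2 * (K * τ + K) ≤ sumF f
    sumF-≥-sides = subst (2 * (K * τ + K) ≤_) (≡-sym (sumF-sides f g (λ _ → refl))) (sumF-≥ (K * τ + K) sideTotal-≥)

  -- Upper bound for bdim(G)

  f₀ : V → ℕ
  -- Just enough to reach p on the opposite side: one step over the chord and `2 + K` from u₁.
  f₀ (outer 0F) = 3 + K
  f₀ (outer 1F) = 1
  f₀ (middle s) = 1
  f₀ (inner s) = 1
  f₀ (br s i (twin σ t 0F)) = 1
  f₀ (br s i _) = 0

  Sep : V → V → Set
  Sep x y = ∃ λ z → Separates {G = G} (f₀ z) (encode z) (encode x) (encode y)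

  sep-sym : ∀ {x y} → Sep x y → Sep y x
  sep-sym (z , sep) = z , separates-sym sep

  sep-self : ∀ {x y} → f₀ x > 0 → ¬ x ≡ y → Sep x y
  sep-self {x} loud x≢y = x , self-separates G₁.connected loud (x≢y ∘ encode-injective)

  -- A neighbour is at distance 1 and any other vertex except `z` is at least 2 away, which even
  -- strength 1 notices.
  sep-neighbour : ∀ z {x y} → f₀ z > 0 → Adj true x z → ¬ y ≡ z → ¬ Adj true y z → Sep x y
  sep-neighbour z {x} {y} loud a y≢z ¬a = z , separates G₁.connected loud loud (a G₁.∷ here) 1<
    where
    1< : ∀ j → G₁.W y z j → 1 < j
    1< j v with G₁.uncons v
    ... | inj₁ y≡z = contradiction y≡z y≢z
    ... | inj₂ (_ , suc i , _ , _ , refl) = s≤s (s≤s z≤n)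
    ... | inj₂ (_ , zero , a′ , v′ , refl) with G₁.uncons v′
    ... | inj₁ refl = contradiction a′ ¬a
    ... | inj₂ (_ , _ , _ , _ , ())

  -- The one place where strength above 1 is needed. On the side of u₀ the distances to compare are
  -- `2 + K` and at least `3 + K`; on the other side both grow by one, and q falls beyond the range.
  sep-near-far : ∀ s i → Sep (br s i near) (br s i far)
  sep-near-far 0F i =
    outer 0F , separates G₁.connected (s≤s z≤n) (n≤1+n _) (G₁.near-outer 0F i)
      λ j v → s≤s⁻¹ (subst (4 + K ≤_) (+-comm j 1) (far-outer 0F i 0F v))
  sep-near-far 1F i =
    outer 0F , separates G₁.connected (s≤s z≤n) (≤-reflexive (+-comm (2 + K) 1))
      (G₁.near-outer 1F i ++ inj₂ chord G₁.∷ here)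
      λ j v → subst₂ _≤_ (cong suc (+-comm 1 (2 + K))) (+-identityʳ j) (far-outer 1F i 0F v)

  data Quiet : Loc → Set where
    collar : Quiet collar
    near : Quiet near
    far : Quiet far
    twin : ∀ σ t → Quiet (twin σ t 1F)

  hub-loud : ∀ σ s → f₀ (hub σ s) > 0
  hub-loud 0F 0F = s≤s z≤n
  hub-loud 0F 1F = s≤s z≤n
  hub-loud 1F s = s≤s z≤n

  loud-or-quiet : ∀ x → f₀ x > 0 ⊎ ∃ λ s → ∃ λ i → ∃ λ l → x ≡ br s i l × Quiet l
  loud-or-quiet (outer s) = inj₁ (hub-loud 0F s)
  loud-or-quiet (middle s) = inj₁ (s≤s z≤n)
  loud-or-quiet (inner s) = inj₁ (s≤s z≤n)
  loud-or-quiet (br s i collar) = inj₂ (s , i , _ , refl , collar)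
  loud-or-quiet (br s i near) = inj₂ (s , i , _ , refl , near)
  loud-or-quiet (br s i far) = inj₂ (s , i , _ , refl , far)
  loud-or-quiet (br s i (twin σ t 0F)) = inj₁ (s≤s z≤n)
  loud-or-quiet (br s i (twin σ t 1F)) = inj₂ (s , i , _ , refl , twin σ t)

  collar-neighbour : ∀ {s i} → Adj true (br s i collar) (br s i (twin 0F (fromℕ k) 0F))
  collar-neighbour = inj₂ (local (to-collar (Fin.toℕ-fromℕ k)))

  loud-neighbour : ∀ s i {l} → Quiet l → ∃ λ l′ → f₀ (br s i l′) > 0 × Adj true (br s i l) (br s i l′)
  loud-neighbour s i collar = _ , s≤s z≤n , collar-neighbour
  loud-neighbour s i near = twin 1F (fromℕ k) 0F , s≤s z≤n , inj₂ (local (to-near (Fin.toℕ-fromℕ k)))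
  loud-neighbour s i far = twin 1F (fromℕ k) 0F , s≤s z≤n , inj₂ (local (to-far (Fin.toℕ-fromℕ k)))
  loud-neighbour s i (twin σ t) = twin σ t 0F , s≤s z≤n , inj₂ (local twins)

  same-branch : ∀ {s i l s′ i′ l′} → Adj true (br s i l) (br s′ i′ l′) → s ≡ s′ × i ≡ i′
  same-branch (inj₁ (local _)) = refl , refl
  same-branch (inj₂ (local _)) = refl , refl

  -- A quiet vertex has a loud neighbour in its own branch, which is adjacent to nothing in other
  -- branches.
  sep-branches : ∀ {s i l s′ i′ l′} → Quiet l → ¬ (s′ ≡ s × i′ ≡ i) → Sep (br s i l) (br s′ i′ l′)
  sep-branches {s} {i} quiet ≢ with loud-neighbour s i quiet
  ... | l″ , loud , a = sep-neighbour (br s i l″) loud a (λ { refl → ≢ (refl , refl) }) (≢ ∘ same-branch)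

  -- The loud vertex just before pair `t` on its chain. The loud twin within the pair would not do,
  -- being adjacent to the following pair as well.
  predecessor : Fin 2 → Fin K → Fin 2 → Fin K → V
  predecessor s i σ zero = hub σ s
  predecessor s i σ (suc t) = br s i (twin σ (inject₁ t) 0F)

  predecessor-loud : ∀ s i σ t → f₀ (predecessor s i σ t) > 0
  predecessor-loud s i σ zero = hub-loud σ s
  predecessor-loud s i σ (suc t) = s≤s z≤n

  predecessor-adj : ∀ s i σ t → Adj true (br s i (twin σ t 1F)) (predecessor s i σ t)
  predecessor-adj s i σ zero = swap (G₁.hub-strand σ first)
  predecessor-adj s i σ (suc t) = inj₂ (local (along (cong suc (≡-sym (Fin.toℕ-inject₁ t)))))

  -- Quiet places that are not adjacent to the predecessor of pair `t` on chain `σ`.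
  data Beyond (σ : Fin 2) (t : Fin K) : Loc → Set where
    collar : Beyond σ t collar
    near : Beyond σ t near
    far : Beyond σ t far
    elsewhere : ∀ {σ′ t′} → ¬ σ′ ≡ σ → Beyond σ t (twin σ′ t′ 1F)
    later : ∀ {t′} → toℕ t < toℕ t′ → Beyond σ t (twin σ t′ 1F)

  hub-adj : ∀ σ {s i l} → Adj true (br s i l) (hub σ s) → First σ l
  hub-adj 0F (inj₂ (outer-strand fst)) = fst
  hub-adj 1F (inj₂ (inner-strand fst)) = fst

  br≢hub : ∀ σ {s s′ i l} → ¬ br s i l ≡ hub σ s′
  br≢hub 0F ()
  br≢hub 1F ()

  beyond≢predecessor : ∀ s i {σ t l} → Beyond σ t l → ¬ br s i l ≡ predecessor s i σ t
  beyond≢predecessor s i {σ} {zero} _ = br≢hub σ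
  beyond≢predecessor s i {t = suc t} (elsewhere _) ()
  beyond≢predecessor s i {t = suc t} (later _) ()

  -- Only the last pair of a chain touches the collar, p or q, and a predecessor inside the chain is
  -- never in the last pair.
  inject₁-not-last : (t : Fin k) → ¬ toℕ (inject₁ t) ≡ k
  inject₁-not-last t eq = <⇒≢ (Fin.toℕ<n t) (≡-trans (≡-sym (Fin.toℕ-inject₁ t)) eq)

  beyond-not-adj : ∀ s i {σ t l} → Beyond σ t l → ¬ Adj true (br s i l) (predecessor s i σ t)
  beyond-not-adj s i {σ} {zero} b a = not-first b (hub-adj σ a)
    where
    not-first : ∀ {l} → Beyond σ zero l → ¬ First σ l
    not-first (elsewhere σ′≢σ) first = σ′≢σ refl
    not-first (later ()) first
  beyond-not-adj s i {t = suc t} collar (inj₁ (local ()))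
  beyond-not-adj s i {t = suc t} collar (inj₂ (local (to-collar eq))) = inject₁-not-last t eq
  beyond-not-adj s i {t = suc t} near (inj₁ (local ()))
  beyond-not-adj s i {t = suc t} near (inj₂ (local (to-near eq))) = inject₁-not-last t eq
  beyond-not-adj s i {t = suc t} far (inj₁ (local ()))
  beyond-not-adj s i {t = suc t} far (inj₂ (local (to-far eq))) = inject₁-not-last t eq
  beyond-not-adj s i {t = suc t} (elsewhere σ′≢σ) (inj₁ (local (along _))) = σ′≢σ refl
  beyond-not-adj s i {t = suc t} (elsewhere σ′≢σ) (inj₂ (local twins)) = σ′≢σ refl
  beyond-not-adj s i {t = suc t} (elsewhere σ′≢σ) (inj₂ (local (along _))) = σ′≢σ refl
  beyond-not-adj s i {t = suc t} (later t<t′) (inj₁ (local (along eq))) =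
    <-asym t<t′ (≤-trans (≤-reflexive (≡-sym (≡-trans (≡-sym (Fin.toℕ-inject₁ t)) eq))) (n≤1+n _))
  beyond-not-adj s i {t = suc t} (later t<t′) (inj₂ (local twins)) =
    <⇒≱ t<t′ (≤-trans (≤-reflexive (Fin.toℕ-inject₁ t)) (n≤1+n _))
  beyond-not-adj s i {t = suc t} (later t<t′) (inj₂ (local (along eq))) =
    <⇒≢ t<t′ (≡-sym (≡-trans eq (cong suc (Fin.toℕ-inject₁ t))))

  sep-beyond : ∀ s i {σ t l} → Beyond σ t l → Sep (br s i (twin σ t 1F)) (br s i l)
  sep-beyond s i {σ} {t} b =
    sep-neighbour (predecessor s i σ t) (predecessor-loud s i σ t) (predecessor-adj s i σ t)
      (beyond≢predecessor s i b) (beyond-not-adj s i b)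

  sep-twins : ∀ s i {σ t σ′ t′} → ¬ (σ ≡ σ′ × t ≡ t′) → Sep (br s i (twin σ t 1F)) (br s i (twin σ′ t′ 1F))
  sep-twins s i {σ} {t} {σ′} {t′} ≢ with σ Fin.≟ σ′ | <-cmp (toℕ t) (toℕ t′)
  ... | no σ≢σ′ | _ = sep-beyond s i (elsewhere (σ≢σ′ ∘ ≡-sym))
  ... | yes refl | tri< t<t′ _ _ = sep-beyond s i (later t<t′)
  ... | yes refl | tri≈ _ t≡t′ _ = contradiction (refl , Fin.toℕ-injective t≡t′) ≢
  -- The pair closer to the hub has to supply the predecessor, so the roles are exchanged.
  ... | yes refl | tri> _ _ t>t′ = sep-sym (sep-beyond s i (later t>t′))

  sep-collar-near : ∀ s i → Sep (br s i collar) (br s i near)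
  sep-collar-near s i = sep-neighbour _ (s≤s z≤n) collar-neighbour (λ ()) λ { (inj₁ (local ())) ; (inj₂ (local ())) }

  sep-collar-far : ∀ s i → Sep (br s i collar) (br s i far)
  sep-collar-far s i = sep-neighbour _ (s≤s z≤n) collar-neighbour (λ ()) λ { (inj₁ (local ())) ; (inj₂ (local ())) }

  sep-local : ∀ s i {l l′} → Quiet l → Quiet l′ → ¬ l ≡ l′ → Sep (br s i l) (br s i l′)
  sep-local s i collar collar ≢ = contradiction refl ≢
  sep-local s i collar near _ = sep-collar-near s i
  sep-local s i collar far _ = sep-collar-far s i
  sep-local s i near collar _ = sep-sym (sep-collar-near s i)
  sep-local s i near near ≢ = contradiction refl ≢
  sep-local s i near far _ = sep-near-far s i
  sep-local s i far collar _ = sep-sym (sep-collar-far s i)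
  sep-local s i far near _ = sep-sym (sep-near-far s i)
  sep-local s i far far ≢ = contradiction refl ≢
  sep-local s i (twin σ t) collar _ = sep-beyond s i collar
  sep-local s i (twin σ t) near _ = sep-beyond s i near
  sep-local s i (twin σ t) far _ = sep-beyond s i far
  sep-local s i collar (twin σ t) _ = sep-sym (sep-beyond s i collar)
  sep-local s i near (twin σ t) _ = sep-sym (sep-beyond s i near)
  sep-local s i far (twin σ t) _ = sep-sym (sep-beyond s i far)
  sep-local s i (twin σ t) (twin σ′ t′) ≢ = sep-twins s i λ { (refl , refl) → ≢ refl }

  sep : ∀ x y → ¬ x ≡ y → Sep x y
  sep x y x≢y with loud-or-quiet x | loud-or-quiet y
  ... | inj₁ loud | _ = sep-self loud x≢y
  ... | inj₂ _ | inj₁ loud = sep-sym (sep-self loud (x≢y ∘ ≡-sym))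
  ... | inj₂ (s , i , l , refl , ql) | inj₂ (s′ , i′ , l′ , refl , ql′) with sameBranch? s i s′ i′
  ... | yes (refl , refl) = sep-local s i ql ql′ λ { refl → x≢y refl }
  ... | no ≢ = sep-branches ql ≢

  f₀-resolving : Resolving G (f₀ ∘ decode)
  f₀-resolving x y x≢y
    with z , separated ← sep (decode x) (decode y)
           (λ eq → x≢y (≡-trans (decode-≡ eq) (encode-decode y)))
    = encode z ,
      subst (λ v → Separates {G = G} (f₀ v) (encode z) x y) (≡-sym (decode-encode z))
        (subst₂ (Separates {G = G} (f₀ z) (encode z)) (encode-decode x) (encode-decode y) separated)

  -- Each side pays `K * τ` for its twins; the hubs pay `3 + K` at u₀ and 1 at each of the other
  -- five.
  f₀-total : sumF (f₀ ∘ decode) ≡ 2 * (K * τ) + (8 + K)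
  f₀-total = begin
    sumF (f₀ ∘ decode)
      ≡⟨ sumF-sides (f₀ ∘ decode) f₀ (cong f₀ ∘ decode-encode) ⟩
    (3 + K + (2 + rest 0F)) + (3 + rest 1F + 0)
      ≡⟨ cong₂ (λ a b → (3 + K + (2 + a)) + (3 + b + 0)) (rest≡ 0F) (rest≡ 1F) ⟩
    (3 + K + (2 + K * τ)) + (3 + K * τ + 0)
      ≡⟨ rearrange K (K * τ) ⟩
    2 * (K * τ) + (8 + K) ∎
    where
    open ≡-Reasoning
    rest : Fin 2 → ℕ
    rest s = sumF (branchTotal f₀ s)
    rest≡ : ∀ s → rest s ≡ K * τ
    rest≡ s =
      sumF-const {K} {branchTotal f₀ s} τ λ i →
      sumF-const {2} {λ σ → sumF λ t → sumF λ e → f₀ (br s i (twin σ t e))} (K * 1) λ σ →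
      sumF-const {K} {λ t → sumF λ e → f₀ (br s i (twin σ t e))} 1 λ t → refl
    rearrange : ∀ a x → (3 + a + (2 + x)) + (3 + x + 0) ≡ 2 * x + (8 + a)
    rearrange = solve 2 (λ a x → (con 3 :+ a :+ (con 2 :+ x)) :+ (con 3 :+ x :+ con 0)
                                 := con 2 :* x :+ (con 8 :+ a)) refl
      where open +-*-Solver

  -- Comparison of the two bounds

  bdim-gap : ∀ {bG bGe} M → IsBdim G bG → IsBdim (Γ false) bGe → K ≡ 13 + M → bG + 5 + M ≤ bGe
  bdim-gap {bG} {bGe} M (_ , bG≤) ((f , res , total) , _) K≡ = begin
    bG + 5 + M ≤⟨ +-monoˡ-≤ M (+-monoˡ-≤ 5 (bG≤ (f₀ ∘ decode) f₀-resolving)) ⟩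
    sumF (f₀ ∘ decode) + 5 + M ≡⟨ cong (λ b → b + 5 + M) f₀-total ⟩
    -- The 13 is the overhead 8 of `f₀` plus the distance 5; with `M` added it equals the second `K`
    -- of the lower bound.
    2 * (K * τ) + (8 + K) + 5 + M ≡⟨ rearrange M K (K * τ) ⟩
    2 * (K * τ) + (K + (13 + M)) ≡⟨ cong (λ c → 2 * (K * τ) + (K + c)) (≡-sym K≡) ⟩
    2 * (K * τ) + (K + K) ≡⟨ rearrange′ K (K * τ) ⟩
    2 * (K * τ + K) ≤⟨ LowerBound.sumF-≥-sides f res ⟩
    sumF f ≡⟨ total ⟩
    bGe ∎
    where
    open ≤-Reasoning
    open +-*-Solver
    rearrange : ∀ m a x → 2 * x + (8 + a) + 5 + m ≡ 2 * x + (a + (13 + m))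
    rearrange = solve 3 (λ m a x → con 2 :* x :+ (con 8 :+ a) :+ con 5 :+ m
                                   := con 2 :* x :+ (a :+ (con 13 :+ m))) refl
    rearrange′ : ∀ a x → 2 * x + (a + a) ≡ 2 * (x + a)
    rearrange′ = solve 2 (λ a x → con 2 :* x :+ (a :+ a) := con 2 :* (x :+ a)) refl

  -- Stated for symbolic k: at k = 12 + M the type checker would unfold the vertex count.
  bdim-jump : ∀ M → K ≡ 13 + M →
    ∃ λ n → Σ (Graph n) λ G → Σ (Fin n) λ u → Σ (Fin n) λ v →
    Connected G × Edge G u v × Connected (removeEdge G u v) ×
    ∃ λ bG → ∃ λ bGe → ∃ λ d →
    IsBdim G bG × IsBdim (removeEdge G u v) bGe ×
    IsDist (removeEdge G u v) u v d ×
    bG + d + M ≤ bGe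
  bdim-jump M K≡ =
    let bG , isG = bdim-exists G₁.connected
        bGe , isGe = bdim-exists G₀.connected
    in size , G , u₀ , u₁ , G₁.connected , G-edge (inj₁ chord) , G₀.connected ,
       bG , bGe , 5 , isG , isGe , outer-distance , bdim-gap M isG isGe K≡

theorem1p9 : (M : ℕ) →
    ∃ λ n → Σ (Graph n) λ G → Σ (Fin n) λ u → Σ (Fin n) λ v →
    Connected G × Edge G u v × Connected (removeEdge G u v) ×
    ∃ λ bG → ∃ λ bGe → ∃ λ d →
    IsBdim G bG × IsBdim (removeEdge G u v) bGe ×
    IsDist (removeEdge G u v) u v d ×
    bG + d + M ≤ bGe
-- The parameter is `k`, one less than `K`, so `12 + M` gives `K` the value `13 + M`.
theorem1p9 M = Construction.bdim-jump (12 + M) M refl
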